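{- Let $k\geq 3$ and let $G$ be a diregular $(2,k,+3)$-digraph. Let $u,v$ be distinct vertices of $G$ having exactly one common out-neighbour $u_2$, and write $N^+(u)=\{u_1,u_2\}$, $N^+(v)=\{v_1,u_2\}$. Then $v_1 \in O(u)$ and $u_1 \in O(v)$.
   Context: A digraph is $k$-geodetic if for every ordered pair of vertices $x,y$ there is at most one directed path from $x$ to $y$ of length at most $k$ (the trivial path of length $0$ counts, so there are no directed cycles of length at most $k$). $M(d,k)=1+d+\dots+d^k$. A diregular $(d,k,+\epsilon)$-digraph is a $k$-geodetic digraph of order $M(d,k)+\epsilon$ in which every vertex has in-degree and out-degree exactly $d$. $N^+(x)$ is the set of out-neighbours of $x$. The distance $d(x,y)$ is the length of a shortest directed path from $x$ to $y$ ($\infty$ if none). The outlier set of a vertex $x$ is $O(x)=\{y\in V(G): d(x,y)\geq k+1\}$; in a diregular $(2,k,+3)$-digraph, $|O(x)|=3$ for every $x$. -}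

module Defs where

open import Data.Bool.Base using (Bool; T)
open import Data.Fin.Base using (Fin)
open import Data.Fin.Subset using (Subset; ∣_∣)
open import Data.List.Base using (map; sum; upTo)
open import Data.Nat.Base using (ℕ; zero; suc; _+_; _^_; _≤_)
open import Data.Product.Base using (∃-syntax; _×_)
open import Data.Vec.Base using (tabulate)
open import Level using (0ℓ)
open import Relation.Binary.Construct.Closure.ReflexiveTransitive using (Star; fold)
open import Relation.Binary.Construct.Add.Supremum.NonStrict _≤_ using (_≤⁺_)
open import Relation.Binary.PropositionalEquality.Core using (_≡_)
open import Relation.Nullary.Construct.Add.Supremum using (_⁺; [_]; ⊤⁺)
open import Relation.Nullary.Negation.Core using (¬_)
open import Relation.Unary using (Pred)

-- Loops are not excluded here; k-geodecity with k ≥ 1 excludes them.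
record Digraph (n : ℕ) : Set where
  field
    arc : Fin n → Fin n → Bool

  Arc : Fin n → Fin n → Set
  Arc x y = T (arc x y)

  N⁺ : Fin n → Subset n
  N⁺ x = tabulate (arc x)

  N⁻ : Fin n → Subset n
  N⁻ y = tabulate (λ x → arc x y)

  -- Vertices may repeat along a path, so that a directed cycle through x is
  -- a path from x to x, distinct from the trivial one.
  Path : Fin n → Fin n → Set
  Path = Star Arc

  length : ∀ {x y} → Path x y → ℕ
  length = fold (λ _ _ → ℕ) (λ _ → suc) zero

  -- The element ⊤⁺ of ℕ ⁺ plays the role of ∞.
  IsDistance : Fin n → Fin n → ℕ ⁺ → Set
  IsDistance x y [ m ] = (∃[ p ] length {x} {y} p ≡ m) × (∀ (q : Path x y) → m ≤ length q)
  IsDistance x y ⊤⁺    = ¬ Path x y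

  O : ℕ → Fin n → Pred (Fin n) 0ℓ
  O k x y = ∃[ δ ] IsDistance x y δ × [ suc k ] ≤⁺ δ

  -- T is proof-irrelevant, so p ≡ q says that p and q visit the same vertices
  -- in the same order.
  Geodetic : ℕ → Set
  Geodetic k = ∀ {x y} (p q : Path x y) → length p ≤ k → length q ≤ k → p ≡ q

M : ℕ → ℕ → ℕ
M d k = sum (map (d ^_) (upTo (suc k)))

record IsDiregular {n : ℕ} (d k ε : ℕ) (G : Digraph n) : Set where
  open Digraph G
  field
    order     : n ≡ M d k + ε
    geodetic  : Geodetic k
    outDegree : ∀ x → ∣ N⁺ x ∣ ≡ d
    inDegree  : ∀ x → ∣ N⁻ x ∣ ≡ d

{-# OPTIONS --safe #-}

-- Write T(x) for the ball of radius k − 1 around x.  If a and b are the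
-- out-neighbours of a vertex, then T(a) and T(b) are disjoint and exactly four
-- vertices lie in neither.  Suppose that some path of length at most k − 1 leads
-- from u₁ to v₁.  Then v ∉ T(u₁).
-- If u₁ → v₁ is an arc, then T(u₁) ∪ T(u₂) misses v and all vertices at distance
-- k − 1 from v₁, of which there are at least four.
-- Otherwise let p be the first vertex after u₁ on the path, s the last one before
-- v₁, q the other out-neighbour of u₁, and w the other out-neighbour of s.  Then
-- T(v₁) ∪ T(u₂) misses v, s, w, one of u and u₁, and some vertex within distance
-- k − 2 of q: q itself, or else a descendant of q at distance exactly k from v₁.
-- In both cases five vertices are missed, a contradiction.
module Submission where

open import Defs
open import Data.Bool.Base using (T)
open import Data.Bool.Properties using (T?; T-≡)
open import Data.Fin.Base using (Fin)
open import Data.Fin.Properties using (_≟_; any?; injective⇒≤)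
open import Data.Fin.Subset using (Subset; ∣_∣; ⁅_⁆; _∪_; _∩_) renaming (_∈_ to _∈ₛ_)
open import Data.Fin.Subset.Properties using (_∈?_; x∈⁅x⁆; x∈⁅y⁆⇒x≡y; ∣⁅x⁆∣≡1; p⊆q⇒∣p∣≤∣q∣; x∈p∩q⁺; x∈p∪q⁺; x∈p∪q⁻)
open import Data.List.Base as List using (List; []; _∷_; _++_; applyUpTo)
open import Data.List.Properties using (length-++; map-upTo)
open import Data.List.Membership.Propositional using () renaming (_∈_ to _∈ₗ_)
open import Data.List.Membership.Propositional.Properties using (∈-lookup; ∈-++⁻)
open import Data.List.Relation.Binary.Disjoint.Propositional using (Disjoint)
open import Data.List.Relation.Unary.All as All using (All; []; _∷_)
open import Data.List.Relation.Unary.AllPairs using ([]; _∷_)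
open import Data.List.Relation.Unary.All.Properties using (¬Any⇒All¬)
open import Data.List.Relation.Unary.Any as Any using (here; there)
open import Data.List.Relation.Unary.Unique.Propositional using (Unique)
open import Data.List.Relation.Unary.Unique.Propositional.Properties using (++⁺)
open import Data.Nat.Base using (ℕ; zero; suc; _+_; _*_; _^_; _∸_; _≤_; _<_; z≤n; s≤s; s≤s⁻¹)
open import Data.Nat.ListAction using (sum)
open import Data.Nat.Properties using (≤-refl; ≤-trans; ≤-reflexive; ≤-antisym; +-comm; +-identityʳ; *-zeroʳ; *-distribˡ-+; +-mono-≤; +-cancelʳ-≤; m+[n∸m]≡n; m≤n⇒m≤1+n; n≤1+n; ≰⇒>; <⇒≱; ∸-monoʳ-≤; module ≤-Reasoning)
open import Data.Product.Base using (∃-syntax; _×_; _,_; proj₁; proj₂)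
open import Data.Sum.Base using (_⊎_; inj₁; inj₂; [_,_]′)
open import Data.Vec.Properties using ([]=⇒lookup; lookup⇒[]=; lookup∘tabulate)
open import Function.Base using (_∘_)
open import Function.Bundles using (module Equivalence)
open import Function.Definitions using (Injective)
open import Relation.Binary.Construct.Add.Supremum.NonStrict _≤_ using ([_]; _≤⊤⁺)
open import Relation.Binary.Construct.Closure.ReflexiveTransitive using (ε; _◅_; _◅◅_)
open import Relation.Binary.PropositionalEquality using (_≡_; _≢_; refl; sym; trans; cong; cong₂; subst; ≢-sym; module ≡-Reasoning)
open import Relation.Nullary.Construct.Add.Supremum using ([_]; ⊤⁺)
open import Relation.Nullary.Decidable using (Dec; yes; no; map′; ¬?; _⊎-dec_; _×-dec_; decidable-stable)
open import Relation.Nullary.Negation using (¬_; contradiction)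
open import Relation.Unary using (_∈_)

-- Counting in finite sets, and the recursion for `M`.

lookup-injective : ∀ {A : Set} {xs : List A} → Unique xs → Injective _≡_ _≡_ (List.lookup xs)
lookup-injective (_ ∷ _)  {Fin.zero}  {Fin.zero}  _  = refl
lookup-injective (x≢ ∷ _) {Fin.zero}  {Fin.suc j} eq = contradiction eq (All.lookup x≢ (∈-lookup j))
lookup-injective (x≢ ∷ _) {Fin.suc i} {Fin.zero}  eq = contradiction (sym eq) (All.lookup x≢ (∈-lookup i))
lookup-injective (_ ∷ !)  {Fin.suc i} {Fin.suc j} eq = cong Fin.suc (lookup-injective ! eq)

unique⇒length≤ : ∀ {n} {xs : List (Fin n)} → Unique xs → List.length xs ≤ n
unique⇒length≤ = injective⇒≤ ∘ lookup-injective

∃∈≢ : ∀ {n} (S : Subset n) → 1 < ∣ S ∣ → ∀ z → ∃[ y ] y ∈ₛ S × y ≢ z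
∃∈≢ S 1<∣S∣ z with any? (λ y → (y ∈? S) ×-dec ¬? (y ≟ z))
... | yes found = found
... | no ¬found = contradiction (≤-trans (p⊆q⇒∣p∣≤∣q∣ S⊆⁅z⁆) (≤-reflexive (∣⁅x⁆∣≡1 z))) (<⇒≱ 1<∣S∣)
  where
  S⊆⁅z⁆ : ∀ {y} → y ∈ₛ S → y ∈ₛ ⁅ z ⁆
  S⊆⁅z⁆ {y} y∈S = subst (_∈ₛ ⁅ z ⁆) (sym y≡z) (x∈⁅x⁆ z)
    where
    y≡z : y ≡ z
    y≡z = decidable-stable (y ≟ z) (λ y≢z → ¬found (y , y∈S , y≢z))

sum-applyUpTo-* : ∀ c (f : ℕ → ℕ) m → sum (applyUpTo (λ i → c * f i) m) ≡ c * sum (applyUpTo f m)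
sum-applyUpTo-* c f zero    = sym (*-zeroʳ c)
sum-applyUpTo-* c f (suc m) =
  trans (cong (c * f 0 +_) (sum-applyUpTo-* c (f ∘ suc) m)) (sym (*-distribˡ-+ c (f 0) _))

M-suc : ∀ d k → M d (suc k) ≡ suc (d * M d k)
M-suc d k = trans (cong sum (map-upTo (d ^_) (suc (suc k))))
  (cong suc (trans (sum-applyUpTo-* d (d ^_) (suc k))
                   (cong (λ xs → d * sum xs) (sym (map-upTo (d ^_) (suc k))))))

-- Reachability within a bounded length, distances and outliers.

module Reachability {n : ℕ} (G : Digraph n) where
  open Digraph G

  ∈N⁺⇒Arc : ∀ {x y} → y ∈ₛ N⁺ x → Arc x y
  ∈N⁺⇒Arc {x} {y} y∈ = subst T (trans (sym ([]=⇒lookup y∈)) (lookup∘tabulate (arc x) y)) _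

  Arc⇒∈N⁺ : ∀ {x y} → Arc x y → y ∈ₛ N⁺ x
  Arc⇒∈N⁺ {x} {y} xy = lookup⇒[]= y (N⁺ x) (trans (lookup∘tabulate (arc x) y) (Equivalence.to T-≡ xy))

  length-◅◅ : ∀ {x y z} (p : Path x y) (q : Path y z) → length (p ◅◅ q) ≡ length p + length q
  length-◅◅ ε       q = refl
  length-◅◅ (_ ◅ p) q = cong suc (length-◅◅ p q)

  Reach : ℕ → Fin n → Fin n → Set
  Reach m x y = ∃[ p ] length {x} {y} p ≤ m

  stay : ∀ {m x} → Reach m x x
  stay = ε , z≤n

  step : ∀ {m x y z} → Arc x y → Reach m y z → Reach (suc m) x z
  step a (p , p≤m) = a ◅ p , s≤s p≤m

  weaken : ∀ {l m x y} → l ≤ m → Reach l x y → Reach m x y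
  weaken l≤m (p , p≤l) = p , ≤-trans p≤l l≤m

  append : ∀ {l m x y z} → Reach l x y → Reach m y z → Reach (l + m) x z
  append (p , p≤l) (q , q≤m) = p ◅◅ q , ≤-trans (≤-reflexive (length-◅◅ p q)) (+-mono-≤ p≤l q≤m)

  snoc : ∀ {m x y z} → Reach m x y → Arc y z → Reach (suc m) x z
  snoc {m} r a = weaken (≤-reflexive (+-comm m 1)) (append r (step {0} a stay))

  -- The length bound gives the search something to recurse on, so later case distinctions on
  -- reachability are constructive.
  reach? : ∀ m x y → Dec (Reach m x y)
  reach? zero    x y = map′ (λ { refl → stay }) (λ { (ε , _) → refl }) (x ≟ y)
  reach? (suc m) x y = map′
    [ (λ { refl → stay }) , (λ { (_ , a , r) → step a r }) ]′
    (λ { (ε , _) → inj₁ refl ; (a ◅ p , p≤m) → inj₂ (_ , a , p , s≤s⁻¹ p≤m) })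
    ((x ≟ y) ⊎-dec any? (λ z → T? (arc x z) ×-dec reach? m z y))

  unsnoc : ∀ {m x z} → Reach (suc m) x z → x ≡ z ⊎ (∃[ y ] Reach m x y × Arc y z)
  unsnoc         (ε , _)           = inj₁ refl
  unsnoc {zero}  (a ◅ ε , _)       = inj₂ (_ , stay , a)
  unsnoc {zero}  (_ ◅ _ ◅ _ , s≤s ())
  unsnoc {suc m} (a ◅ p , s≤s p≤m) with unsnoc {m} (p , p≤m)
  ... | inj₁ refl        = inj₂ (_ , stay , a)
  ... | inj₂ (y , r , b) = inj₂ (y , step a r , b)

  vertices : ∀ {x y} → Path x y → List (Fin n)
  vertices {x} ε       = x ∷ []
  vertices {x} (_ ◅ p) = x ∷ vertices p

  length<length-vertices : ∀ {x y} (p : Path x y) → length p < List.length (vertices p)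
  length<length-vertices ε       = ≤-refl
  length<length-vertices (_ ◅ p) = s≤s (length<length-vertices p)

  SimplePath : Fin n → Fin n → Set
  SimplePath x y = ∃[ p ] Unique (vertices {x} {y} p)

  suffix : ∀ {x y z} (p : Path x y) → Unique (vertices p) → z ∈ₗ vertices p → SimplePath z y
  suffix ε       !       (here refl) = ε , !
  suffix (a ◅ p) !       (here refl) = a ◅ p , !
  suffix (_ ◅ p) (_ ∷ !) (there z∈)  = suffix p ! z∈

  simplify : ∀ {x y} → Path x y → SimplePath x y
  simplify ε = ε , [] ∷ []
  simplify {x} (a ◅ p) with simplify p
  ... | q , ! with Any.any? (x ≟_) (vertices q)
  -- The detour is cut out: only the part from the later visit to `x` is kept.
  ...   | yes x∈ = suffix q ! x∈
  ...   | no  x∉ = a ◅ q , ¬Any⇒All¬ _ x∉ ∷ !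

  -- A simple path has fewer than `n` arcs, so `n` bounds the search for any path at all.
  path⇒reach : ∀ {x y} → Path x y → Reach n x y
  path⇒reach p with simplify p
  ... | q , ! = q , ≤-trans (n≤1+n _) (≤-trans (length<length-vertices q) (unique⇒length≤ !))

  -- The bound is lowered until it fails; the path at hand then has exactly the least length.
  reach⇒distance : ∀ m {x y} → Reach m x y → ∃[ d ] IsDistance x y [ d ]
  reach⇒distance zero    (p , p≤0) = 0 , (p , ≤-antisym p≤0 z≤n) , λ _ → z≤n
  reach⇒distance (suc m) {x} {y} (p , p≤1+m) with reach? m x y
  ... | yes r = reach⇒distance m r
  ... | no ¬r = suc m , (p , ≤-antisym p≤1+m (m<length p)) , m<length
    where
    m<length : ∀ q → m < length q
    m<length q = ≰⇒> (λ q≤m → ¬r (q , q≤m))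

  -- `O` asks for an actual distance, possibly infinite; reachability within `n` steps decides
  -- between the finite and the infinite case.
  ¬reach⇒∈O : ∀ {k x y} → ¬ Reach k x y → y ∈ O k x
  ¬reach⇒∈O {k} {x} {y} ¬r with reach? n x y
  ... | no ¬r′ = ⊤⁺ , (¬r′ ∘ path⇒reach) , (_ ≤⊤⁺)
  ... | yes r′ with reach⇒distance n r′
  ...   | d , (p , refl) , min = [ d ] , ((p , refl) , min) , [ ≰⇒> (λ p≤k → ¬r (p , p≤k)) ]

-- Geodetic digraphs of out-degree 2.

-- κ stands for k − 1.
module Geodetic {n : ℕ} (G : Digraph n) (κ : ℕ) (geodetic : Digraph.Geodetic G (suc κ))
                (outDegree : ∀ x → ∣ Digraph.N⁺ G x ∣ ≡ 2) where
  open Digraph G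
  open Reachability G

  otherChild : ∀ x z → ∃[ y ] Arc x y × y ≢ z
  otherChild x z with ∃∈≢ (N⁺ x) (≤-reflexive (sym (outDegree x))) z
  ... | y , y∈ , y≢z = y , ∈N⁺⇒Arc y∈ , y≢z

  -- `left` avoids `x` only because `otherChild` must be given some vertex to avoid.
  left right : Fin n → Fin n
  left  x = proj₁ (otherChild x x)
  right x = proj₁ (otherChild x (left x))

  arc-left : ∀ x → Arc x (left x)
  arc-left x = proj₁ (proj₂ (otherChild x x))

  arc-right : ∀ x → Arc x (right x)
  arc-right x = proj₁ (proj₂ (otherChild x (left x)))

  left≢right : ∀ x → left x ≢ right x
  left≢right x = ≢-sym (proj₂ (proj₂ (otherChild x (left x))))

  descend : ∀ m x → ∃[ y ] ∃[ p ] length {x} {y} p ≡ m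
  descend zero    x = x , ε , refl
  descend (suc m) x with descend m (left x)
  ... | y , p , eq = y , arc-left x ◅ p , cong suc eq

  -- Prefixing the arcs yields two paths from `x` to `t` of length at most k that differ in their
  -- second vertex.
  diverge : ∀ {x y z t} → Arc x y → Arc x z → y ≢ z → Reach κ y t → ¬ Reach κ z t
  diverge xy xz y≢z (p , p≤κ) (q , q≤κ) with geodetic (xy ◅ p) (xz ◅ q) (s≤s p≤κ) (s≤s q≤κ)
  ... | refl = y≢z refl

  acyclic : ∀ {x y} → Arc x y → ¬ Reach κ y x
  acyclic xy (p , p≤κ) with geodetic (xy ◅ p) ε (s≤s p≤κ) z≤n
  ... | ()

  -- Otherwise two paths of length at most k, with the same ends, would have different lengths.
  far : ∀ {x y} (p : Path x y) → length p ≡ suc κ → ¬ Reach κ x y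
  far p eq (q , q≤κ) with geodetic p q (≤-reflexive eq) (m≤n⇒m≤1+n q≤κ)
  ... | refl = <⇒≱ (≤-reflexive (sym eq)) q≤κ

  -- A list with one entry per sequence of at most `m` choices of `left` or `right`: its length is
  -- always `M 2 m`, and geodecity serves to exclude repetitions.
  ball : ℕ → Fin n → List (Fin n)
  ball zero    x = x ∷ []
  ball (suc m) x = x ∷ ball m (left x) ++ ball m (right x)

  length-ball : ∀ m x → List.length (ball m x) ≡ M 2 m
  length-ball zero    x = refl
  length-ball (suc m) x = begin
    suc (List.length (ball m (left x) ++ ball m (right x)))               ≡⟨ cong suc (length-++ (ball m (left x))) ⟩
    suc (List.length (ball m (left x)) + List.length (ball m (right x)))  ≡⟨ cong suc (cong₂ _+_ (length-ball m (left x)) (length-ball m (right x))) ⟩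
    suc (M 2 m + M 2 m)                                                   ≡⟨ cong (λ l → suc (M 2 m + l)) (+-identityʳ (M 2 m)) ⟨
    suc (2 * M 2 m)                                                       ≡⟨ M-suc 2 m ⟨
    M 2 (suc m)                                                           ∎
    where open ≡-Reasoning

  ∈ball⇒reach : ∀ m {x y} → y ∈ₗ ball m x → Reach m x y
  ∈ball⇒reach zero (here refl) = stay
  ∈ball⇒reach (suc m) (here refl) = stay
  ∈ball⇒reach (suc m) {x} (there y∈) with ∈-++⁻ (ball m (left x)) y∈
  ... | inj₁ y∈l = step (arc-left x) (∈ball⇒reach m y∈l)
  ... | inj₂ y∈r = step (arc-right x) (∈ball⇒reach m y∈r)

  balls-disjoint : ∀ {m x a b} → m ≤ κ → Arc x a → Arc x b → a ≢ b → Disjoint (ball m a) (ball m b)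
  balls-disjoint {m} m≤κ xa xb a≢b (y∈a , y∈b) =
    diverge xa xb a≢b (weaken m≤κ (∈ball⇒reach m y∈a)) (weaken m≤κ (∈ball⇒reach m y∈b))

  ball-unique : ∀ m x → m ≤ suc κ → Unique (ball m x)
  ball-unique zero    x _ = [] ∷ []
  ball-unique (suc m) x (s≤s m≤κ) =
    All.tabulate root∉ ∷
    ++⁺ (ball-unique m (left x) (m≤n⇒m≤1+n m≤κ)) (ball-unique m (right x) (m≤n⇒m≤1+n m≤κ))
        (balls-disjoint m≤κ (arc-left x) (arc-right x) (left≢right x))
    where
    root∉ : ∀ {y} → y ∈ₗ ball m (left x) ++ ball m (right x) → x ≢ y
    root∉ y∈ refl with ∈-++⁻ (ball m (left x)) y∈
    ... | inj₁ x∈l = acyclic (arc-left x) (weaken m≤κ (∈ball⇒reach m x∈l))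
    ... | inj₂ x∈r = acyclic (arc-right x) (weaken m≤κ (∈ball⇒reach m x∈r))

  Misses : Fin n → Fin n → Fin n → Set
  Misses a b y = ¬ Reach κ a y × ¬ Reach κ b y

  -- The two disjoint balls hold `2 * M 2 κ`, that is M(2,k) - 1, of the M(2,k) + `e` vertices,
  -- which leaves `e` + 1.
  missed-count : ∀ {e x a b xs} → n ≡ M 2 (suc κ) + e → Arc x a → Arc x b → a ≢ b →
                 Unique xs → All (Misses a b) xs → List.length xs ≤ suc e
  missed-count {e} {a = a} {b} {xs} order xa xb a≢b xs! miss = +-cancelʳ-≤ (2 * M 2 κ) _ _ (begin
    List.length xs + 2 * M 2 κ                                            ≡⟨ cong (λ l → List.length xs + (M 2 κ + l)) (+-identityʳ (M 2 κ)) ⟩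
    List.length xs + (M 2 κ + M 2 κ)                                      ≡⟨ cong (List.length xs +_) (cong₂ _+_ (length-ball κ a) (length-ball κ b)) ⟨
    List.length xs + (List.length (ball κ a) + List.length (ball κ b))    ≡⟨ cong (List.length xs +_) (length-++ (ball κ a)) ⟨
    List.length xs + List.length (ball κ a ++ ball κ b)                   ≡⟨ length-++ xs ⟨
    List.length (xs ++ ball κ a ++ ball κ b)                              ≤⟨ unique⇒length≤ all! ⟩
    n                                                                     ≡⟨ order ⟩
    M 2 (suc κ) + e                                                       ≡⟨ cong (_+ e) (M-suc 2 κ) ⟩
    suc (2 * M 2 κ + e)                                                   ≡⟨ cong suc (+-comm (2 * M 2 κ) e) ⟩
    suc e + 2 * M 2 κ                                                     ∎)
    where
    open ≤-Reasoning
    missed : Disjoint xs (ball κ a ++ ball κ b)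
    missed (y∈xs , y∈) with All.lookup miss y∈xs | ∈-++⁻ (ball κ a) y∈
    ... | ¬a , _ | inj₁ y∈a = ¬a (∈ball⇒reach κ y∈a)
    ... | _ , ¬b | inj₂ y∈b = ¬b (∈ball⇒reach κ y∈b)

    all! : Unique (xs ++ ball κ a ++ ball κ b)
    all! = ++⁺ xs! (++⁺ (ball-unique κ a (n≤1+n κ)) (ball-unique κ b (n≤1+n κ)) (balls-disjoint ≤-refl xa xb a≢b)) missed

  -- Two vertices sharing an out-neighbour.

  record Fork (u v u₁ u₂ v₁ : Fin n) : Set where
    field
      uu₁ : Arc u u₁
      uu₂ : Arc u u₂
      vv₁ : Arc v v₁
      vu₂ : Arc v u₂
      u≢v : u ≢ v
      u₁≢u₂ : u₁ ≢ u₂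
      v₁≢u₂ : v₁ ≢ u₂
      u₁≢v₁ : u₁ ≢ v₁

    -- By this symmetry T(v₁) and T(u₂) are disjoint too, and one half of the theorem yields the
    -- other.
    mirror : Fork v u v₁ u₂ u₁
    mirror = record
      { uu₁ = vv₁ ; uu₂ = vu₂ ; vv₁ = uu₁ ; vu₂ = uu₂
      ; u≢v = ≢-sym u≢v ; u₁≢u₂ = v₁≢u₂ ; v₁≢u₂ = u₁≢u₂ ; u₁≢v₁ = ≢-sym u₁≢v₁ }

    branches-disjoint : ∀ {y} → Reach κ u₁ y → ¬ Reach κ u₂ y
    branches-disjoint = diverge uu₁ uu₂ u₁≢u₂

    -- A path from u₁ to v can be prolonged to v₁; by uniqueness it is then the given
    -- path without its last arc, hence short enough to be prolonged to u₂ as well.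
    v∉ball-u₁ : Reach κ u₁ v₁ → ¬ Reach κ u₁ v
    v∉ball-u₁ (p , p≤κ) (q , q≤κ)
      with geodetic p (q ◅◅ (vv₁ ◅ ε)) (m≤n⇒m≤1+n p≤κ) (proj₂ (snoc (q , q≤κ) vv₁))
    ... | refl = branches-disjoint (q▻u₂ , ≤-trans (≤-reflexive same) p≤κ) stay
      where
      q▻u₂ : Path u₁ u₂
      q▻u₂ = q ◅◅ (vu₂ ◅ ε)

      same : length q▻u₂ ≡ length (q ◅◅ (vv₁ ◅ ε))
      same = trans (length-◅◅ q _) (sym (length-◅◅ q _))

-- Five missed vertices when the excess is 3.

-- j stands for k − 3.
module Excess3 {n : ℕ} (G : Digraph n) (j : ℕ) (geodetic : Digraph.Geodetic G (3 + j))
               (outDegree : ∀ x → ∣ Digraph.N⁺ G x ∣ ≡ 2) (order : n ≡ M 2 (3 + j) + 3) where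
  open Digraph G
  open Reachability G
  open Geodetic G (2 + j) geodetic outDegree

  module _ {u v u₁ u₂ v₁ : Fin n} (F : Fork u v u₁ u₂ v₁) where
    open Fork F

    -- The four vertices are the grandchildren of some `t` at depth k - 3 below `v₁`. They lie in
    -- T(v₁), hence not in T(u₂); through the arc they end paths of length exactly k from `u₁`,
    -- hence are not in T(u₁).
    ¬arc-u₁v₁ : ¬ Arc u₁ v₁
    ¬arc-u₁v₁ u₁v₁ with descend j v₁
    ... | t , p , |p|≡j =
      -- Five missed vertices against the permitted 3 + 1.
      <⇒≱ ≤-refl (missed-count order uu₁ uu₂ u₁≢u₂ distinct
        ((v∉ball-u₁ (step u₁v₁ stay) , acyclic vu₂) ∷
         leaf ta (arc-left a) ∷ leaf ta (arc-right a) ∷ leaf tb (arc-left b) ∷ leaf tb (arc-right b) ∷ []))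
      where
      a b : Fin n
      a = left t
      b = right t

      ta : Arc t a
      ta = arc-left t

      tb : Arc t b
      tb = arc-right t

      deep : ∀ {x y} → Arc t x → Arc x y → ∃[ q ] length {v₁} {y} q ≡ 2 + j
      deep tx xy = p ◅◅ (tx ◅ xy ◅ ε) , trans (length-◅◅ p _) (trans (+-comm _ 2) (cong (2 +_) |p|≡j))

      reach-deep : ∀ {x y} → Arc t x → Arc x y → Reach (2 + j) v₁ y
      reach-deep tx xy with deep tx xy
      ... | q , |q| = q , ≤-reflexive |q|

      leaf : ∀ {x y} → Arc t x → Arc x y → Misses u₁ u₂ y
      leaf tx xy with deep tx xy
      ... | q , |q| = far (u₁v₁ ◅ q) (cong suc |q|) , Fork.branches-disjoint mirror (reach-deep tx xy)

      v≢leaf : ∀ {x y} → Arc t x → Arc x y → v ≢ y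
      v≢leaf tx xy refl = acyclic vv₁ (reach-deep tx xy)

      cousins : ∀ {y z} → Arc a y → Arc b z → y ≢ z
      cousins ay bz refl = diverge ta tb (left≢right t) (step ay stay) (step bz stay)

      distinct : Unique (v ∷ left a ∷ right a ∷ left b ∷ right b ∷ [])
      distinct =
        (v≢leaf ta (arc-left a) ∷ v≢leaf ta (arc-right a) ∷ v≢leaf tb (arc-left b) ∷ v≢leaf tb (arc-right b) ∷ []) ∷
        (left≢right a ∷ cousins (arc-left a) (arc-left b) ∷ cousins (arc-left a) (arc-right b) ∷ []) ∷
        (cousins (arc-right a) (arc-left b) ∷ cousins (arc-right a) (arc-right b) ∷ []) ∷
        (left≢right b ∷ []) ∷ [] ∷ []

    -- If T(v₁) contains `u₁`, the mirrored `v∉ball-u₁` keeps `u` out of it; if not, `u₁` itself is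
    -- missed. The last clause separates `e` from the other missed vertices below `u₁`: equality
    -- would close a short cycle.
    missed-ancestor : Reach (2 + j) u₁ v₁ →
      ∃[ e ] Misses v₁ u₂ e × v ≢ e × (∀ {c y} → Arc u₁ c → Reach (suc j) c y → e ≢ y)
    missed-ancestor r with reach? (2 + j) v₁ u₁
    ... | yes r′ = u , (Fork.v∉ball-u₁ mirror r′ , acyclic uu₂) , ≢-sym u≢v , λ { u₁c s refl → acyclic uu₁ (step u₁c s) }
    ... | no ¬r′ = u₁ , (¬r′ , branches-disjoint stay) , (λ { refl → v∉ball-u₁ r stay }) , λ { u₁c s refl → acyclic u₁c (weaken (n≤1+n _) s) }

    -- If T(v₁) contains `q`, the path `σ` from `v₁` to `q` is prolonged to length exactly k, so its
    -- end escapes T(v₁). As `σ` has at least two arcs, the added part has at most k - 2, so that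
    -- end stays in T(u₁), away from T(u₂).
    missed-descendant : ∀ {p q} → Arc u₁ p → Arc u₁ q → p ≢ q → Reach (suc j) p v₁ →
      ∃[ y ] Reach (suc j) q y × Misses v₁ u₂ y
    missed-descendant {p} {q} u₁p u₁q p≢q p⇝v₁ with reach? (2 + j) v₁ q
    ... | no ¬r = q , stay , ¬r , branches-disjoint (step u₁q stay)
    ... | yes (σ , σ≤) with descend ((3 + j) ∸ length σ) q
    ...   | y , ρ , |ρ| = y , q⇝y , far (σ ◅◅ ρ) |σρ| , branches-disjoint (step u₁q q⇝y)
      where
      2≤σ : 2 ≤ length σ
      -- A shorter `σ` would let `p` reach its sibling `q` via `v₁` within k - 1 arcs.
      2≤σ = ≰⇒> (λ σ≤1 → diverge u₁p u₁q p≢q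
        (weaken (≤-reflexive (+-comm (suc j) 1)) (append p⇝v₁ (σ , σ≤1))) stay)

      q⇝y : Reach (suc j) q y
      q⇝y = ρ , ≤-trans (≤-reflexive |ρ|) (∸-monoʳ-≤ (3 + j) 2≤σ)

      |σρ| : length (σ ◅◅ ρ) ≡ 3 + j
      |σρ| = trans (length-◅◅ σ ρ) (trans (cong (length σ +_) |ρ|) (m+[n∸m]≡n (m≤n⇒m≤1+n σ≤)))

    -- Among the missed vertices, `s`, `w` and `y` lie in T(u₁), hence not in T(u₂). `s` in T(v₁)
    -- would close a cycle, and `w` is a sibling of `v₁`. `v` differs from these three by lying
    -- outside T(u₁), and `y` from `s` and `w` by lying below `q` instead of `p`.
    v₁∉ball-u₁ : ¬ Reach (2 + j) u₁ v₁
    v₁∉ball-u₁ (ε , _) = u₁≢v₁ refl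
    v₁∉ball-u₁ r@(_◅_ {j = p} u₁p π , s≤s π≤) with unsnoc (π , π≤)
    ... | inj₁ refl = ¬arc-u₁v₁ u₁p
    -- `s` is within k - 3 of `p`, so `w` is still within k - 2.
    ... | inj₂ (s , p⇝s , sv₁) with otherChild s v₁ | otherChild u₁ p
    ... | w , sw , w≢v₁ | q , u₁q , q≢p
      with missed-ancestor r | missed-descendant u₁p u₁q (≢-sym q≢p) (π , π≤)
    ... | e , e-missed , v≢e , e≢ | y , q⇝y , y-missed =
      <⇒≱ ≤-refl (missed-count order vv₁ vu₂ v₁≢u₂ distinct
        ((acyclic vv₁ , acyclic vu₂) ∷ e-missed ∷ s-missed ∷ w-missed ∷ y-missed ∷ []))
      where
      p⇝s′ : Reach (suc j) p s
      p⇝s′ = weaken (n≤1+n j) p⇝s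

      p⇝w : Reach (suc j) p w
      p⇝w = snoc p⇝s sw

      s-missed : Misses v₁ u₂ s
      s-missed = acyclic sv₁ , branches-disjoint (step u₁p p⇝s′)

      w-missed : Misses v₁ u₂ w
      w-missed = (λ v₁⇝w → diverge sv₁ sw (≢-sym w≢v₁) v₁⇝w stay) , branches-disjoint (step u₁p p⇝w)

      v≢ : ∀ {c z} → Arc u₁ c → Reach (suc j) c z → v ≢ z
      v≢ u₁c c⇝z refl = v∉ball-u₁ r (step u₁c c⇝z)

      cousins : ∀ {z} → Reach (suc j) p z → z ≢ y
      cousins p⇝z refl = diverge u₁p u₁q (≢-sym q≢p) (weaken (n≤1+n _) p⇝z) (weaken (n≤1+n _) q⇝y)

      distinct : Unique (v ∷ e ∷ s ∷ w ∷ y ∷ [])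
      distinct =
        (v≢e ∷ v≢ u₁p p⇝s′ ∷ v≢ u₁p p⇝w ∷ v≢ u₁q q⇝y ∷ []) ∷
        (e≢ u₁p p⇝s′ ∷ e≢ u₁p p⇝w ∷ e≢ u₁q q⇝y ∷ []) ∷
        ((λ { refl → acyclic sw stay }) ∷ cousins p⇝s′ ∷ []) ∷
        (cousins p⇝w ∷ []) ∷ [] ∷ []

    v₁∈O : (∀ {y} → Arc u y → y ≡ u₁ ⊎ y ≡ u₂) → v₁ ∈ O (3 + j) u
    v₁∈O N⁺u = ¬reach⇒∈O unreachable
      where
      unreachable : ¬ Reach (3 + j) u v₁
      -- Here `u` is `v₁`, so `u₂` would lie in both T(v₁) and T(u₂).
      unreachable (ε , _) = Fork.branches-disjoint mirror (step uu₂ stay) stay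
      unreachable (a ◅ p , s≤s p≤) with N⁺u a
      ... | inj₁ refl = v₁∉ball-u₁ (p , p≤)
      ... | inj₂ refl = Fork.branches-disjoint mirror stay (p , p≤)

theorem3 : ∀ (k : ℕ) → 3 ≤ k →
    ∀ {n : ℕ} (G : Digraph n) → IsDiregular 2 k 3 G →
    let open Digraph G in
    ∀ (u v u₁ u₂ v₁ : Fin n) → u ≢ v →
    N⁺ u ∩ N⁺ v ≡ ⁅ u₂ ⁆ →
    N⁺ u ≡ ⁅ u₁ ⁆ ∪ ⁅ u₂ ⁆ →
    N⁺ v ≡ ⁅ v₁ ⁆ ∪ ⁅ u₂ ⁆ →
    (v₁ ∈ O k u) × (u₁ ∈ O k v)
theorem3 (suc (suc (suc j))) (s≤s (s≤s (s≤s _))) G diregular u v u₁ u₂ v₁ u≢v common N⁺u N⁺v =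
  v₁∈O fork (children N⁺u) , v₁∈O (Fork.mirror fork) (children N⁺v)
  where
  open Digraph G
  open Reachability G
  open IsDiregular diregular
  open Geodetic G (2 + j) geodetic outDegree
  open Excess3 G j geodetic outDegree order

  children : ∀ {x a b} → N⁺ x ≡ ⁅ a ⁆ ∪ ⁅ b ⁆ → ∀ {y} → Arc x y → y ≡ a ⊎ y ≡ b
  children {x} {a} {b} N⁺x xy with x∈p∪q⁻ ⁅ a ⁆ ⁅ b ⁆ (subst (_ ∈ₛ_) N⁺x (Arc⇒∈N⁺ xy))
  ... | inj₁ y∈a = inj₁ (x∈⁅y⁆⇒x≡y a y∈a)
  ... | inj₂ y∈b = inj₂ (x∈⁅y⁆⇒x≡y b y∈b)

  arc₁ : ∀ {x a b} → N⁺ x ≡ ⁅ a ⁆ ∪ ⁅ b ⁆ → Arc x a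
  arc₁ {a = a} N⁺x = ∈N⁺⇒Arc (subst (a ∈ₛ_) (sym N⁺x) (x∈p∪q⁺ (inj₁ (x∈⁅x⁆ a))))

  arc₂ : ∀ {x a b} → N⁺ x ≡ ⁅ a ⁆ ∪ ⁅ b ⁆ → Arc x b
  arc₂ {b = b} N⁺x = ∈N⁺⇒Arc (subst (b ∈ₛ_) (sym N⁺x) (x∈p∪q⁺ (inj₂ (x∈⁅x⁆ b))))

  -- Out-degree 2 supplies an out-neighbour other than `a`, which must then be `b`.
  children-distinct : ∀ {x a b} → N⁺ x ≡ ⁅ a ⁆ ∪ ⁅ b ⁆ → a ≢ b
  children-distinct {x} {a} N⁺x refl with otherChild x a
  ... | y , xy , y≢a = [ y≢a , y≢a ]′ (children N⁺x xy)

  u₁≢v₁ : u₁ ≢ v₁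
  -- A shared vertex lies in the intersection, so it would equal `u₂`.
  u₁≢v₁ refl = children-distinct N⁺u (x∈⁅y⁆⇒x≡y u₂ (subst (u₁ ∈ₛ_) common
    (x∈p∩q⁺ (Arc⇒∈N⁺ (arc₁ N⁺u) , Arc⇒∈N⁺ (arc₁ N⁺v)))))

  fork : Fork u v u₁ u₂ v₁
  fork = record
    { uu₁ = arc₁ N⁺u ; uu₂ = arc₂ N⁺u ; vv₁ = arc₁ N⁺v ; vu₂ = arc₂ N⁺v
    ; u≢v = u≢v ; u₁≢u₂ = children-distinct N⁺u ; v₁≢u₂ = children-distinct N⁺v
    ; u₁≢v₁ = u₁≢v₁ }
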